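{- Let $p$ be an odd prime with $p\equiv 3 \pmod 4$ and $p\neq 7$. Then $C_{Q_p,\mathbf 1}=9$.
   Context: For an odd prime $p$, $\mathbb Z_p=\mathbb Z/p\mathbb Z$, $U(p)$ is its group of units, and $Q_p=\{x^2:x\in U(p)\}$. A sequence of length $k$ in $\mathbb Z_p$ is an element of $\mathbb Z_p^k$. A sequence $(x_1,\ldots,x_k)$ in $\mathbb Z_p$ is called a $(Q_p,\mathbf 1)$-weighted zero-sum sequence if there exist $a_1,\ldots,a_k\in Q_p$ such that $a_1x_1+\cdots+a_kx_k=0$ and $a_1+\cdots+a_k=0$ in $\mathbb Z_p$. The constant $C_{Q_p,\mathbf 1}$ is the least positive integer $k$ such that every sequence in $\mathbb Z_p$ of length $k$ has a (non-empty) $(Q_p,\mathbf 1)$-weighted zero-sum subsequence consisting of consecutive terms. -}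

module Defs where

open import Algebra.Bundles using (CommutativeRing)
import Algebra.Definitions
import Algebra.Properties.CommutativeMonoid.Sum
open import Algebra.Structures using (IsCommutativeRing)
open import Data.Fin.Base using (Fin; toℕ)
open import Data.Integer.Base using (ℤ; +_; -_; _-_; 0ℤ; 1ℤ)
  renaming (_+_ to _+ᶻ_; _*_ to _*ᶻ_)
open import Data.Integer.Divisibility.Signed using (divides) renaming (_∣_ to _∣ᶻ_)
import Data.Integer.Properties as ℤ
open import Data.Integer.Solver using (module +-*-Solver)
open import Data.Nat.Base using (ℕ; suc; _+_; _≤_; _<_)
open import Data.Product.Base using (∃-syntax; Σ-syntax; _×_; _,_)
open import Data.Vec.Functional using (Vector)
open import Function.Base using (_∘_)
open import Level using (0ℓ)
open import Relation.Binary.PropositionalEquality.Core using (_≡_; refl; sym; trans; cong; cong₂)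
open import Relation.Binary.Structures using (IsEquivalence)

-- A record rather than a synonym for divisibility, so that Agda can infer
-- x and y from a proof of congruence.
infix 4 _≡_[mod_]
record _≡_[mod_] (x y : ℤ) (n : ℕ) : Set where
  constructor congruent
  field n∣x-y : (+ n) ∣ᶻ (x - y)

private module _ (n : ℕ) where
  open +-*-Solver

  ≡⇒≡mod : ∀ {x y} → x ≡ y → x ≡ y [mod n ]
  ≡⇒≡mod {x} refl = congruent (divides 0ℤ (ℤ.+-inverseʳ x))

  ≡mod-isEquivalence : IsEquivalence (_≡_[mod n ])
  ≡mod-isEquivalence = record
    { refl  = ≡⇒≡mod refl
    ; sym   = λ { {x} {y} (congruent (divides q eq)) → congruent (divides (- q)
        (trans (solve 2 (λ x y → y :- x := :- (x :- y)) refl x y)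
        (trans (cong -_ eq) (ℤ.neg-distribˡ-* q (+ n))))) }
    ; trans = λ { {x} {y} {z} (congruent (divides q eq)) (congruent (divides r eq′)) →
        congruent (divides (q +ᶻ r)
        (trans (solve 3 (λ x y z → x :- z := (x :- y) :+ (y :- z)) refl x y z)
        (trans (cong₂ _+ᶻ_ eq eq′) (sym (ℤ.*-distribʳ-+ (+ n) q r))))) }
    }

  +-cong-mod : ∀ {x y u v} → x ≡ y [mod n ] → u ≡ v [mod n ] → x +ᶻ u ≡ y +ᶻ v [mod n ]
  +-cong-mod {x} {y} {u} {v} (congruent (divides q eq)) (congruent (divides r eq′)) =
    congruent (divides (q +ᶻ r)
      (trans (solve 4 (λ x y u v → (x :+ u) :- (y :+ v) := (x :- y) :+ (u :- v)) refl x y u v)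
      (trans (cong₂ _+ᶻ_ eq eq′) (sym (ℤ.*-distribʳ-+ (+ n) q r)))))

  *-cong-mod : ∀ {x y u v} → x ≡ y [mod n ] → u ≡ v [mod n ] → x *ᶻ u ≡ y *ᶻ v [mod n ]
  *-cong-mod {x} {y} {u} {v} (congruent (divides q eq)) (congruent (divides r eq′)) =
    congruent (divides (q *ᶻ u +ᶻ y *ᶻ r)
      (trans (solve 4 (λ x y u v → x :* u :- y :* v := (x :- y) :* u :+ y :* (u :- v)) refl x y u v)
      (trans (cong₂ (λ s t → s *ᶻ u +ᶻ y *ᶻ t) eq eq′)
      (solve 5 (λ q r u y m → (q :* m) :* u :+ y :* (r :* m) := (q :* u :+ y :* r) :* m)
        refl q r u y (+ n)))))

  neg-cong-mod : ∀ {x y} → x ≡ y [mod n ] → - x ≡ - y [mod n ]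
  neg-cong-mod {x} {y} (congruent (divides q eq)) = congruent (divides (- q)
    (trans (solve 2 (λ x y → (:- x) :- (:- y) := :- (x :- y)) refl x y)
    (trans (cong -_ eq) (ℤ.neg-distribˡ-* q (+ n)))))

  ≡mod-isCommutativeRing : IsCommutativeRing (_≡_[mod n ]) _+ᶻ_ _*ᶻ_ -_ 0ℤ 1ℤ
  ≡mod-isCommutativeRing = record
    { isRing = record
      { +-isAbelianGroup = record
        { isGroup = record
          { isMonoid = record
            { isSemigroup = record
              { isMagma = record { isEquivalence = ≡mod-isEquivalence ; ∙-cong = +-cong-mod }
              ; assoc   = λ x y z → ≡⇒≡mod (ℤ.+-assoc x y z)
              }
            ; identity = (λ x → ≡⇒≡mod (ℤ.+-identityˡ x)) , (λ x → ≡⇒≡mod (ℤ.+-identityʳ x))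
            }
          ; inverse = (λ x → ≡⇒≡mod (ℤ.+-inverseˡ x)) , (λ x → ≡⇒≡mod (ℤ.+-inverseʳ x))
          ; ⁻¹-cong = neg-cong-mod
          }
        ; comm = λ x y → ≡⇒≡mod (ℤ.+-comm x y)
        }
      ; *-cong     = *-cong-mod
      ; *-assoc    = λ x y z → ≡⇒≡mod (ℤ.*-assoc x y z)
      ; *-identity = (λ x → ≡⇒≡mod (ℤ.*-identityˡ x)) , (λ x → ≡⇒≡mod (ℤ.*-identityʳ x))
      ; distrib    = (λ x y z → ≡⇒≡mod (ℤ.*-distribˡ-+ x y z)) , (λ x y z → ≡⇒≡mod (ℤ.*-distribʳ-+ x y z))
      }
    ; *-comm = λ x y → ≡⇒≡mod (ℤ.*-comm x y)
    }

-- The quotient ring ℤ/nℤ, as the setoid of integers under congruence modulo n.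
ℤ/_ : ℕ → CommutativeRing 0ℓ 0ℓ
ℤ/ n = record { isCommutativeRing = ≡mod-isCommutativeRing n }

-- An index map ι selects the subsequence x ∘ ι of a sequence x; its terms are
-- consecutive when the selected positions are s, s + 1, s + 2, ….
Consecutive : ∀ {m k} → (Fin m → Fin k) → Set
Consecutive ι = ∃[ s ] ∀ j → toℕ (ι j) ≡ s + toℕ j

IsLeastPositive : (ℕ → Set) → ℕ → Set
IsLeastPositive P k = 0 < k × P k × (∀ j → 0 < j → P j → k ≤ j)

module _ (p : ℕ) where
  open CommutativeRing (ℤ/ p)
    using (Carrier; _≈_; _*_; 0#; 1#; +-commutativeMonoid)
  open Algebra.Definitions _≈_ using (Invertible)
  open Algebra.Properties.CommutativeMonoid.Sum +-commutativeMonoid using (sum-syntax)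

  U : Carrier → Set
  U = Invertible 1# _*_

  Q : Carrier → Set
  Q a = ∃[ x ] U x × a ≈ x * x

  IsQ1WeightedZeroSum : ∀ {k} → Vector Carrier k → Set
  IsQ1WeightedZeroSum {k} x =
    Σ[ a ∈ Vector Carrier k ] (∀ i → Q (a i)) × ∑[ i < k ] (a i * x i) ≈ 0# × ∑[ i < k ] a i ≈ 0#

  HasConsecutiveQ1ZeroSum : ∀ {k} → Vector Carrier k → Set
  HasConsecutiveQ1ZeroSum {k} x =
    ∃[ m ] Σ[ ι ∈ (Fin (suc m) → Fin k) ] Consecutive ι × IsQ1WeightedZeroSum (x ∘ ι)

  -- IsCQ1 c says that the constant C_{Q_p,𝟏} exists and equals c.
  IsCQ1 : ℕ → Set
  IsCQ1 = IsLeastPositive λ k → (x : Vector Carrier k) → HasConsecutiveQ1ZeroSum x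

{-# OPTIONS --safe #-}
-- Lower bound: in the sequence 0, 0, 1, 0, 0, 1, 0, 0 every block of consecutive
-- terms has length 1 or 2 or contains one or two ones, so a weighted sum or a
-- total weight is a residue or a sum of two residues; these do not vanish, as -1
-- is a nonresidue.
--
-- Upper bound for p ≠ 3, 7: every nonzero element is a residue up to sign, so
-- three nonzero elements are annihilated by residue weights obtained by rescaling
-- 1 + k - (k + 1) = 0, with k and -(k + 1) residues, or 9 + 16 - 25 = 0; exchanging
-- two terms gives a second solution, and with it a nonzero total weight unless the
-- three elements coincide. If a value c occurs three times among the nine terms,
-- either one of the three blocks of three is constantly c, or each contains a term
-- other than c, and then the weights of the terms other than c and of those equal
-- to c settle the two equations in turn. If no value occurs three times, subtract
-- the first term: six nonzero terms, split into two triples, take any nonzero total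
-- weight, which the first term and its only possible repetition compensate.
--
-- For p = 3 all weights are 1, and among the sums of the three blocks of three some
-- consecutive ones add up to zero.
module Submission where

open import Defs
open import Algebra.Bundles using (CommutativeRing)
import Algebra.Properties.CommutativeSemiring.Binomial as Binomial
import Algebra.Properties.CommutativeSemiring.Exp as Exp
import Algebra.Properties.Semiring.Mult as Mult
import Algebra.Properties.Semiring.Sum as Sum
open import Data.Bool.Base using (Bool; true; false; if_then_else_)
open import Data.Empty using (⊥)
open import Data.Fin.Base as Fin using (Fin; zero; suc; toℕ; combine; punchIn; _↑ˡ_; _↑ʳ_; inject₁; fromℕ; fromℕ<)
open import Data.Fin.Patterns
import Data.Fin.Properties as Fin
open import Data.Integer.Base as ℤ using (ℤ; +_; -[1+_])
import Data.Integer.Divisibility.Signed as ℤ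
import Data.Integer.Properties as ℤ
open import Data.Integer.Solver using (module +-*-Solver)
open import Data.Nat.Base as ℕ using (ℕ; zero; suc; _%_; _∸_; _!; NonZero; z≤n; s≤s)
open import Data.Nat.Combinatorics using (_C_; nCn≡1; nCk≡n!/k![n-k]!; k![n∸k]!∣n!)
import Data.Nat.DivMod as ℕ
open import Data.Nat.Divisibility using (_∣_; _∤_; divides; ∣⇒≤; ∣1⇒≡1; ∣-refl; m∣m*n)
import Data.Nat.Properties as ℕ
open import Data.Nat.Tactic.RingSolver using () renaming (solve-∀ to ℕ-solve-∀)
open import Data.Nat.Primality using (Prime; euclidsLemma; prime⇒irreducible; prime⇒nonZero; prime?; prime[2]; ¬prime[1])
open import Data.Product.Base using (∃-syntax; Σ-syntax; _×_; _,_; proj₁; proj₂; map₂)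
open import Data.Sum.Base using (_⊎_; inj₁; inj₂; [_,_]′)
open import Data.Unit.Base using (⊤; tt)
open import Data.Vec.Functional using (Vector; []; _∷_; tail; removeAt; insertAt; updateAt)
open import Data.Vec.Functional.Properties using (insertAt-lookup; insertAt-punchIn; updateAt-minimal)
open import Function.Base using (_∘_; const; id)
open import Relation.Binary.PropositionalEquality.Core as ≡ using (_≡_; _≢_)
open import Relation.Nullary.Decidable using (Dec; decidable-stable; yes; no; map′; _×-dec_; _⊎-dec_; _→-dec_; ¬?; from-yes)
open import Relation.Nullary.Negation using (¬_; contradiction)

-- Divisibility of binomial coefficients by a prime.

p∤k! : ∀ {p k} → Prime p → k ℕ.< p → p ∤ k !
p∤k! {k = zero} pr _ p∣1 = ¬prime[1] (≡.subst Prime (∣1⇒≡1 p∣1) pr)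
p∤k! {k = suc k} pr k<p p∣k! with euclidsLemma (suc k) (k !) pr p∣k!
... | inj₁ p∣1+k = contradiction (∣⇒≤ p∣1+k) (ℕ.<⇒≱ k<p)
... | inj₂ p∣k!′ = p∤k! pr (ℕ.<⇒≤ k<p) p∣k!′

-- The prime divides `p !`, the product of the coefficient with two factorials that are built from
-- factors smaller than `p`.
p∣pCk : ∀ {p k} → Prime p → 0 ℕ.< k → k ℕ.< p → p ∣ p C k
p∣pCk {p@(suc p′)} {k} pr 0<k k<p
  with euclidsLemma (p C k) (k ! ℕ.* (p ∸ k) !) pr
         (≡.subst (p ∣_) (≡.sym C*d≡p!) (m∣m*n (p′ !)))
  where
  instance _ = k ℕ.!* (p ∸ k) !≢0
  C*d≡p! : (p C k) ℕ.* (k ! ℕ.* (p ∸ k) !) ≡ p !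
  C*d≡p! = ≡.trans (≡.cong (ℕ._* (k ! ℕ.* (p ∸ k) !)) (nCk≡n!/k![n-k]! (ℕ.<⇒≤ k<p)))
                   (ℕ.m/n*n≡m (k![n∸k]!∣n! (ℕ.<⇒≤ k<p)))
... | inj₁ p∣C = p∣C
... | inj₂ p∣d with euclidsLemma (k !) ((p ∸ k) !) pr p∣d
...   | inj₁ p∣k! = contradiction p∣k! (p∤k! pr k<p)
...   | inj₂ p∣[p-k]! = contradiction p∣[p-k]! (p∤k! pr (ℕ.∸-monoʳ-< 0<k (ℕ.<⇒≤ k<p)))

-- Arithmetic modulo n.

-- Congruence proofs below are certificates: a difference is exhibited as a
-- linear combination of differences already known to vanish.
module Mod (n : ℕ) where
  open CommutativeRing (ℤ/ n) public hiding (zero)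
  open Exp commutativeSemiring public using (_^_; ^-congˡ; ^-homo-*; ^-distrib-*)
  open Mult semiring public using () renaming (_×_ to _×ᴿ_)
  open Sum semiring public
    using (sum; sum-syntax; sum-cong-≋; sum-remove; sum-init-last; sum-replicate-zero)
  open +-*-Solver public using (solve; _:+_; _:*_; _:-_; :-_; _:=_; con)

  linear₁ : ∀ k {e f x y} → e ≈ f → x - y ≡ k * (e - f) → x ≈ y
  linear₁ k (congruent e≈f) eq = congruent (≡.subst (+ n ℤ.∣_) (≡.sym eq) (ℤ.∣n⇒∣m*n k e≈f))

  linear₂ : ∀ k l {e f g h x y} → e ≈ f → g ≈ h → x - y ≡ k * (e - f) + l * (g - h) → x ≈ y
  linear₂ k l (congruent e≈f) (congruent g≈h) eq = congruent
    (≡.subst (+ n ℤ.∣_) (≡.sym eq) (ℤ.∣m∣n⇒∣m+n (ℤ.∣n⇒∣m*n k e≈f) (ℤ.∣n⇒∣m*n l g≈h)))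

  infix 4 _≈?_
  _≈?_ : ∀ x y → Dec (x ≈ y)
  x ≈? y = map′ congruent _≡_[mod_].n∣x-y (+ n ℤ.∣? (x - y))

  ≈0⇒∣ : ∀ {k} → + k ≈ 0# → n ∣ k
  ≈0⇒∣ {k} (congruent n∣k-0) = ≡.subst (λ i → n ∣ ℤ.∣ i ∣) (ℤ.+-identityʳ (+ k)) (ℤ.∣⇒∣ᵤ n∣k-0)

  ∣⇒≈0 : ∀ {k} → n ∣ k → + k ≈ 0#
  ∣⇒≈0 {k} n∣k = congruent (ℤ.∣ᵤ⇒∣ (≡.subst (λ i → n ∣ ℤ.∣ i ∣) (≡.sym (ℤ.+-identityʳ (+ k))) n∣k))

  -- The binomial theorem writes its coefficients as iterated sums; as integer factors they can be
  -- seen to vanish modulo `n`.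
  ×ᴿ≡* : ∀ k x → k ×ᴿ x ≡ + k * x
  ×ᴿ≡* zero    x = ≡.refl
  ×ᴿ≡* (suc k) x = ≡.trans (≡.cong (λ i → x + i) (×ᴿ≡* k x)) (≡.sym (ℤ.suc-* (+ k) x))

  x-y≈0⇒x≈y : ∀ {x y} → x - y ≈ 0# → x ≈ y
  x-y≈0⇒x≈y {x} {y} x-y≈0 = linear₁ 1# x-y≈0
    (solve 2 (λ x y → x :- y := con 1# :* ((x :- y) :- con 0#)) ≡.refl x y)

  -≉0 : ∀ {x} → x ≉ 0# → - x ≉ 0#
  -≉0 {x} x≉0 -x≈0 = x≉0 (linear₁ (- 1#) -x≈0 (solve 1 (λ x → x :- con 0# := con (- 1#) :* (:- x :- con 0#)) ≡.refl x))

-- The field of p elements: integrality, Fermat's little theorem, inverses.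

module PrimeField {p : ℕ} (pr : Prime p) where
  open Mod p public

  private instance
    p≢0 : NonZero p
    p≢0 = prime⇒nonZero pr

  integral : ∀ {x y} → x * y ≈ 0# → x ≈ 0# ⊎ y ≈ 0#
  integral {x} {y} (congruent p∣xy)
    with euclidsLemma ℤ.∣ x ∣ ℤ.∣ y ∣ pr
           (≡.subst (p ∣_) (≡.trans (≡.cong ℤ.∣_∣ (ℤ.+-identityʳ (x * y))) (ℤ.∣i*j∣≡∣i∣*∣j∣ x y)) (ℤ.∣⇒∣ᵤ p∣xy))
  ... | inj₁ p∣x = inj₁ (congruent (≡.subst (+ p ℤ.∣_) (≡.sym (ℤ.+-identityʳ x)) (ℤ.∣ᵤ⇒∣ p∣x)))
  ... | inj₂ p∣y = inj₂ (congruent (≡.subst (+ p ℤ.∣_) (≡.sym (ℤ.+-identityʳ y)) (ℤ.∣ᵤ⇒∣ p∣y)))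

  *-≉0 : ∀ {x y} → x ≉ 0# → y ≉ 0# → x * y ≉ 0#
  *-≉0 x≉0 y≉0 xy≈0 = [ x≉0 , y≉0 ]′ (integral xy≈0)

  *-cancelˡ : ∀ {x y z} → x ≉ 0# → x * y ≈ x * z → y ≈ z
  *-cancelˡ {x} {y} {z} x≉0 xy≈xz with integral {x} {y - z} (linear₁ 1# xy≈xz
    (solve 3 (λ x y z → (x :* (y :- z)) :- con 0# := con 1# :* (x :* y :- x :* z)) ≡.refl x y z))
  ... | inj₁ x≈0   = contradiction x≈0 x≉0
  ... | inj₂ y-z≈0 = x-y≈0⇒x≈y y-z≈0

  x²≈1⇒x≈±1 : ∀ {x} → x * x ≈ 1# → x ≈ 1# ⊎ x ≈ - 1#
  x²≈1⇒x≈±1 {x} x²≈1 with integral {x - 1#} {x - - 1#} (linear₁ 1# x²≈1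
    (solve 1 (λ x → (x :- con 1#) :* (x :- con (- 1#)) :- con 0# := con 1# :* (x :* x :- con 1#)) ≡.refl x))
  ... | inj₁ x-1≈0 = inj₁ (x-y≈0⇒x≈y x-1≈0)
  ... | inj₂ x+1≈0 = inj₂ (x-y≈0⇒x≈y x+1≈0)

  1≉0 : 1# ≉ 0#
  1≉0 1≈0 = ¬prime[1] (≡.subst Prime (∣1⇒≡1 (≈0⇒∣ 1≈0)) pr)

  prime≉0 : ∀ {q} → Prime q → p ≢ q → + q ≉ 0#
  prime≉0 qr p≢q q≈0 with prime⇒irreducible qr (≈0⇒∣ q≈0)
  ... | inj₁ ≡.refl = ¬prime[1] pr
  ... | inj₂ p≡q    = p≢q p≡q

  1^n≈1 : ∀ n → 1# ^ n ≈ 1#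
  1^n≈1 zero    = refl
  1^n≈1 (suc n) = trans (*-identityˡ _) (1^n≈1 n)

  -- All terms of the binomial expansion but the first and the last carry a coefficient divisible by
  -- `p`.
  frobenius : ∀ x → (x + 1#) ^ p ≈ x ^ p + 1#
  frobenius = go p ≡.refl
    where
    -- Matching on a variable equal to `p` exposes it as a successor, which splitting off the last
    -- term requires.
    go : ∀ n → n ≡ p → ∀ x → (x + 1#) ^ n ≈ x ^ n + 1#
    go zero    ≡.refl = contradiction pr (λ ())
    go (suc n) ≡.refl x = begin
      (x + 1#) ^ p                                ≈⟨ theorem p x 1# ⟩
      t 0F + sum (tail t)                         ≈⟨ +-congˡ {t 0F} (sum-init-last (tail t)) ⟩
      t 0F + (sum (tail t ∘ inject₁) + t (suc (fromℕ n)))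
        ≈⟨ +-cong {t 0F} {1#} t₀≈1 (+-cong (trans (sum-cong-≋ middle) (sum-replicate-zero n)) tₙ≈xᵖ) ⟩
      1# + (0# + x ^ p)                           ≈⟨ +-congˡ {1#} (+-identityˡ (x ^ p)) ⟩
      1# + x ^ p                                  ≈⟨ +-comm 1# (x ^ p) ⟩
      x ^ p + 1#                                  ∎
      where
      open Binomial commutativeSemiring using (theorem; binomialTerm; binomial)
      open import Relation.Binary.Reasoning.Setoid setoid
      t : Fin (suc p) → Carrier
      t = binomialTerm x 1# p
      t₀≈1 : t 0F ≈ 1#
      t₀≈1 = trans (reflexive (×ᴿ≡* 1 (1# * 1# ^ p))) (trans (*-identityˡ _) (trans (*-identityˡ _) (1^n≈1 p)))
      middle : ∀ i → t (suc (inject₁ i)) ≈ 0#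
      middle i = begin
        t (suc (inject₁ i))            ≡⟨ ×ᴿ≡* (p C k) b ⟩
        + (p C k) * b                  ≈⟨ *-congʳ {b} (∣⇒≈0 (p∣pCk pr (s≤s z≤n) k<p)) ⟩
        0# * b                         ≈⟨ zeroˡ b ⟩
        0#                             ∎
        where
        k = suc (toℕ (inject₁ i))
        b = binomial x 1# p (suc (inject₁ i))
        k<p : k ℕ.< p
        k<p = s≤s (≡.subst (ℕ._< n) (≡.sym (Fin.toℕ-inject₁ i)) (Fin.toℕ<n i))
      tₙ≈xᵖ : t (suc (fromℕ n)) ≈ x ^ p
      tₙ≈xᵖ rewrite Fin.toℕ-fromℕ n | nCn≡1 p | ℕ.n∸n≡0 n = trans (+-identityʳ _) (*-identityʳ _)

  -- Induction over the natural numbers with `frobenius` as the step; every integer is congruent to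
  -- a natural number.
  x^p≈x : ∀ x → x ^ p ≈ x
  x^p≈x x = trans (^-congˡ p (proj₂ (nonneg x))) (trans (nat (proj₁ (nonneg x))) (sym (proj₂ (nonneg x))))
    where
    0^n≈0 : ∀ n → .{{NonZero n}} → 0# ^ n ≈ 0#
    0^n≈0 (suc n) = zeroˡ (0# ^ n)
    nat : ∀ k → (+ k) ^ p ≈ + k
    nat zero    = 0^n≈0 p
    nat (suc k) = begin
      (+ suc k) ^ p     ≡⟨ ≡.cong (_^ p) (≡.cong +_ (ℕ.+-comm 1 k)) ⟩
      (+ k + 1#) ^ p    ≈⟨ frobenius (+ k) ⟩
      (+ k) ^ p + 1#    ≈⟨ +-congʳ {1#} (nat k) ⟩
      + k + 1#          ≡⟨ ≡.cong +_ (ℕ.+-comm k 1) ⟩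
      + suc k           ∎
      where open import Relation.Binary.Reasoning.Setoid setoid
    nonneg : ∀ x → ∃[ k ] x ≈ + k
    nonneg (+ k)      = k , refl
    nonneg -[1+ k ]   = k′ , congruent (ℤ.divides (ℤ.- (+ suc k)) eq)
      where
      -- Adding `suc k` copies of `p` to the negative integer makes it nonnegative, since `p` is at
      -- least 1.
      k′ = suc k ℕ.* p ∸ suc k
      eq : -[1+ k ] - + k′ ≡ ℤ.- (+ suc k) * + p
      eq = ≡.trans (≡.cong (λ i → -[1+ k ] - i) (≡.sym (ℤ.⊖-≥ (ℕ.m≤m*n (suc k) p))))
           (≡.trans (≡.cong (λ i → -[1+ k ] - i) (≡.sym (ℤ.m-n≡m⊖n (suc k ℕ.* p) (suc k))))
           (≡.trans (≡.cong (λ i → -[1+ k ] - (i - + suc k)) (ℤ.pos-* (suc k) p))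
           (solve 2 (λ a p → :- a :- (a :* p :- a) := :- a :* p) ≡.refl (+ suc k) (+ p))))

  fermat : ∀ {x} → x ≉ 0# → x ^ ℕ.pred p ≈ 1#
  fermat {x} x≉0 = *-cancelˡ {x} x≉0 (begin
    x ^ suc (ℕ.pred p)  ≡⟨ ≡.cong (x ^_) (ℕ.suc-pred p) ⟩
    x ^ p               ≈⟨ x^p≈x x ⟩
    x                   ≈⟨ *-identityʳ x ⟨
    x * 1#              ∎)
    where open import Relation.Binary.Reasoning.Setoid setoid

  -- By Fermat's theorem the power with exponent p - 2 is an inverse.
  inverse : ∀ {x} → x ≉ 0# → ∃[ y ] x * y ≈ 1#
  inverse {x} x≉0 = go (ℕ.pred p) (ℕ.suc-pred p)
    where
    go : ∀ n → suc n ≡ p → ∃[ y ] x * y ≈ 1#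
    go zero    1≡p = contradiction (≡.subst Prime (≡.sym 1≡p) pr) ¬prime[1]
    go (suc n) 2+n≡p = x ^ n , ≡.subst (λ k → x ^ k ≈ 1#) (≡.cong ℕ.pred (≡.sym 2+n≡p)) (fermat x≉0)

-- Squares modulo a prime congruent to 3 modulo 4.

-- The exponents h = (p - 1) / 2 and k = (p - 3) / 4 are kept as variables, since
-- powers with a computed exponent unfold into products of integers.
module 3mod4 {p h k : ℕ} (pr : Prime p) (p%4≡3 : p % 4 ≡ 3)
  (p≡1+2h : p ≡ suc (h ℕ.+ h)) (h≡1+2k : h ≡ suc (k ℕ.+ k)) where
  open PrimeField pr public

  private
    x^h*x^h≈1 : ∀ {x} → x ≉ 0# → x ^ h * x ^ h ≈ 1#
    x^h*x^h≈1 {x} x≉0 = trans (sym (^-homo-* x h h))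
      (≡.subst (λ k → x ^ k ≈ 1#) (≡.cong ℕ.pred p≡1+2h) (fermat x≉0))

  2≉0 : + 2 ≉ 0#
  2≉0 = prime≉0 prime[2] λ { ≡.refl → contradiction p%4≡3 (λ ()) }

  5≉0 : + 5 ≉ 0#
  5≉0 = prime≉0 (from-yes (prime? 5)) λ { ≡.refl → contradiction p%4≡3 (λ ()) }

  square : ∀ {x} → x ≉ 0# → Q p (x * x)
  square {x} x≉0 with y , xy≈1 ← inverse x≉0 = x , (y , trans (*-comm y x) xy≈1 , xy≈1) , refl

  U⇒≉0 : ∀ {x} → U p x → x ≉ 0#
  U⇒≉0 {x} (y , yx≈1 , _) x≈0 = 1≉0 (trans (sym yx≈1) (trans (*-congˡ {y} x≈0) (zeroʳ y)))

  Q⇒≉0 : ∀ {a} → Q p a → a ≉ 0#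
  Q⇒≉0 (x , ux , a≈x²) a≈0 = *-≉0 (U⇒≉0 ux) (U⇒≉0 ux) (trans (sym a≈x²) a≈0)

  Q-resp : ∀ {a b} → a ≈ b → Q p a → Q p b
  Q-resp a≈b (x , ux , a≈x²) = x , ux , trans (sym a≈b) a≈x²

  Q-* : ∀ {a b} → Q p a → Q p b → Q p (a * b)
  Q-* (x , ux , a≈x²) (y , uy , b≈y²) =
    Q-resp (trans (reflexive (solve 2 (λ x y → (x :* y) :* (x :* y) := (x :* x) :* (y :* y)) ≡.refl x y))
                  (sym (*-cong a≈x² b≈y²)))
           (square (*-≉0 (U⇒≉0 ux) (U⇒≉0 uy)))

  Q-1 : Q p 1#
  Q-1 = square 1≉0

  Q-inverse : ∀ {a} → Q p a → ∃[ b ] Q p b × a * b ≈ 1#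
  Q-inverse {a} qa@(x , (y , _ , xy≈1) , a≈x²) = y * y , square y≉0 ,
    trans (*-congʳ {y * y} a≈x²) (trans
      (reflexive (solve 2 (λ x y → (x :* x) :* (y :* y) := (x :* y) :* (x :* y)) ≡.refl x y))
      (*-cong xy≈1 xy≈1))
    where
    y≉0 : y ≉ 0#
    y≉0 y≈0 = 1≉0 (trans (sym xy≈1) (trans (*-congˡ {x} y≈0) (zeroʳ x)))

  -- The easy half of Euler's criterion: the h-th power of x² is x^(p - 1).
  Q⇒^h≈1 : ∀ {a} → Q p a → a ^ h ≈ 1#
  Q⇒^h≈1 {a} (x , ux , a≈x²) = begin
    a ^ h           ≈⟨ ^-congˡ h a≈x² ⟩
    (x * x) ^ h     ≈⟨ ^-distrib-* x x h ⟩
    x ^ h * x ^ h   ≈⟨ x^h*x^h≈1 (U⇒≉0 ux) ⟩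
    1#              ∎
    where open import Relation.Binary.Reasoning.Setoid setoid

  -- The exponent h = 2k + 1 is odd because p is 3 modulo 4.
  [-1]^h≈-1 : (- 1#) ^ h ≈ - 1#
  [-1]^h≈-1 = begin
    (- 1#) ^ h                        ≡⟨ ≡.cong ((- 1#) ^_) h≡1+2k ⟩
    - 1# * (- 1#) ^ (k ℕ.+ k)         ≈⟨ *-congˡ { - 1# } (trans (^-homo-* (- 1#) k k) (sym (^-distrib-* (- 1#) (- 1#) k))) ⟩
    - 1# * 1# ^ k                     ≈⟨ *-congˡ { - 1# } (1^n≈1 k) ⟩
    - 1#                              ∎
    where open import Relation.Binary.Reasoning.Setoid setoid

  -- Raising a = -b to the power h would give 1 = -1. This is the form in which -1 being a
  -- nonresidue is used.
  Q+Q≉0 : ∀ {a b} → Q p a → Q p b → a + b ≉ 0#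
  Q+Q≉0 {a} {b} qa qb a+b≈0 = 2≉0 (linear₁ 1# (begin
    1#                 ≈⟨ Q⇒^h≈1 qa ⟨
    a ^ h              ≈⟨ ^-congˡ h {a} { - 1# * b} (linear₁ 1# a+b≈0
                            (solve 2 (λ a b → a :- (:- con 1# :* b) := con 1# :* (a :+ b :- con 0#)) ≡.refl a b)) ⟩
    (- 1# * b) ^ h     ≈⟨ ^-distrib-* (- 1#) b h ⟩
    (- 1#) ^ h * b ^ h ≈⟨ *-cong [-1]^h≈-1 (Q⇒^h≈1 qb) ⟩
    - 1#               ∎) ≡.refl)
    where open import Relation.Binary.Reasoning.Setoid setoid

  private
    -- The candidate square root of x or -x: its square is x^(2k + 2) = x^(h + 1).
    root : Carrier → Carrier
    root x = x ^ suc k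

    root² : ∀ x → root x * root x ≈ x * x ^ h
    root² x = trans (sym (^-homo-* x (suc k) (suc k))) (reflexive (≡.cong (x ^_)
      (≡.cong suc (≡.trans (ℕ.+-suc k k) (≡.sym h≡1+2k)))))

    square-root : ∀ {x} y → y * y ≈ x → x ≉ 0# → Q p x
    square-root y y*y≈x x≉0 = Q-resp y*y≈x
      (square λ y≈0 → x≉0 (trans (sym y*y≈x) (trans (*-congˡ {y} y≈0) (zeroʳ y))))

  -- x ^ (h + 1) = ± x, and h + 1 is even.
  ±Q : ∀ {x} → x ≉ 0# → Q p x ⊎ Q p (- x)
  ±Q {x} x≉0 with x²≈1⇒x≈±1 (x^h*x^h≈1 x≉0)
  ... | inj₁ x^h≈1  = inj₁ (square-root (root x) (trans (root² x) (trans (*-congˡ {x} x^h≈1) (*-identityʳ x))) x≉0)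
  ... | inj₂ x^h≈-1 = inj₂ (square-root (root x) (trans (root² x) (trans (*-congˡ {x} x^h≈-1)
    (reflexive (solve 1 (λ x → x :* con (- 1#) := :- x) ≡.refl x)))) (-≉0 x≉0))

  -- The field `α≉β` ensures that exchanging the first two coefficients can change a total weight.
  record ZeroSumOfResidues : Set where
    constructor residues
    field
      {α β γ}   : Carrier
      α∈Q       : Q p α
      β∈Q       : Q p β
      γ∈Q       : Q p γ
      α+β+γ≈0   : α + β + γ ≈ 0#
      α≉β       : α ≉ β

  Q-balanced : + 3 ≉ 0# → ZeroSumOfResidues
  -- The number `h + k + k` is p - 2, so that the climb from 1 ends at p - 1.
  Q-balanced 3≉0 = distinct (switch (h ℕ.+ k ℕ.+ k)
    (≡.sym (≡.trans p≡1+2h (≡.cong suc (≡.trans (≡.cong (h ℕ.+_) h≡1+2k) (lemma h k))))))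
    where
    Switch : Set
    Switch = ∃[ k ] Q p k × Q p (- (1# + k))
    <p⇒≉0 : ∀ {n} → suc n ℕ.< p → + suc n ≉ 0#
    <p⇒≉0 1+n<p e = ℕ.<⇒≱ 1+n<p (∣⇒≤ (≈0⇒∣ e))
    step : ∀ {n} → Q p (+ suc n) → Q p (+ suc (suc n)) ⊎ Q p (- (+ suc (suc n))) → Switch ⊎ Q p (+ suc (suc n))
    step q (inj₁ q′) = inj₂ q′
    step q (inj₂ q′) = inj₁ (_ , q , q′)
    -- Some residue k is followed by a nonresidue, since 1 is a residue and p - 1 is not.
    climb : ∀ n → suc n ℕ.< p → Switch ⊎ Q p (+ suc n)
    climb zero    _     = inj₂ Q-1
    climb (suc n) 2+n<p with climb n (ℕ.<⇒≤ 2+n<p)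
    ... | inj₁ s = inj₁ s
    ... | inj₂ q = step q (±Q (<p⇒≉0 2+n<p))
    lemma : ∀ h k → h ℕ.+ suc (k ℕ.+ k) ≡ suc (h ℕ.+ k ℕ.+ k)
    lemma = ℕ-solve-∀
    switch : ∀ n → suc (suc n) ≡ p → Switch
    switch n eq with climb n (ℕ.≤-reflexive eq)
    ... | inj₁ s = s
    -- If p - 1 were a residue, 1 and p - 1 would be two residues with sum zero.
    ... | inj₂ q = contradiction (≡.subst (λ k → + k ≈ 0#) (≡.sym eq) (∣⇒≈0 ∣-refl)) (Q+Q≉0 Q-1 q)
    sum₁ : ∀ k → 1# + k + - (1# + k) ≡ 0#
    sum₁ = solve 1 (λ k → con 1# :+ k :+ :- (con 1# :+ k) := con 0#) ≡.refl
    sum₂ : ∀ k → 1# + - (1# + k) + k ≡ 0#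
    sum₂ = solve 1 (λ k → con 1# :+ :- (con 1# :+ k) :+ k := con 0#) ≡.refl
    three : ∀ k → + 3 - 0# ≡ 1# * (1# - - (1# + k)) + 1# * (1# - k)
    three = solve 1 (λ k → con (+ 3) :- con 0# := con 1# :* (con 1# :- :- (con 1# :+ k)) :+ con 1# :* (con 1# :- k)) ≡.refl
    distinct : Switch → ZeroSumOfResidues
    distinct (k , qk , qs) with 1# ≈? k
    ... | no 1≉k  = residues Q-1 qk qs (reflexive (sum₁ k)) 1≉k
    -- For k = 1 the summands are 1, 1, -2; placing -2 second makes the first two differ, since 1 =
    -- -2 would mean 3 = 0.
    ... | yes 1≈k = residues Q-1 qs qk (reflexive (sum₂ k)) λ 1≈s → 3≉0 (linear₂ 1# 1# 1≈s 1≈k (three k))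

-- Residue weights annihilating three nonzero elements, for p other than 3 and 7.

module Large {p h k : ℕ} (pr : Prime p) (p%4≡3 : p % 4 ≡ 3)
  (p≡1+2h : p ≡ suc (h ℕ.+ h)) (h≡1+2k : h ≡ suc (k ℕ.+ k))
  (p≢3 : p ≢ 3) (p≢7 : p ≢ 7) where
  open 3mod4 {p} {h} {k} pr p%4≡3 p≡1+2h h≡1+2k public

  3≉0 : + 3 ≉ 0#
  3≉0 = prime≉0 (from-yes (prime? 3)) p≢3

  7≉0 : + 7 ≉ 0#
  7≉0 = prime≉0 (from-yes (prime? 7)) p≢7

  Q-4 : Q p (+ 4)
  Q-4 = square 2≉0

  Q-9 : Q p (+ 9)
  Q-9 = square 3≉0

  Q-16 : Q p (+ 16)
  Q-16 = Q-* Q-4 Q-4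

  Q-25 : Q p (+ 25)
  Q-25 = square 5≉0

  record Weights (v₁ v₂ v₃ : Carrier) : Set where
    constructor weights
    field
      {a₁ a₂ a₃} : Carrier
      a₁∈Q       : Q p a₁
      a₂∈Q       : Q p a₂
      a₃∈Q       : Q p a₃
      av≈0       : a₁ * v₁ + a₂ * v₂ + a₃ * v₃ ≈ 0#

    total : Carrier
    total = a₁ + a₂ + a₃
  open Weights using (total)

  -- Three equal nonzero elements force the total weight to vanish, so a nonzero total is asked for
  -- only when they do not all coincide.
  Solvable : (v₁ v₂ v₃ : Carrier) → Set
  Solvable v₁ v₂ v₃ = Σ[ w ∈ Weights v₁ v₂ v₃ ] (¬ (v₁ ≈ v₂ × v₂ ≈ v₃) → total w ≉ 0#)

  rotate : ∀ {u v w} → Solvable v w u → Solvable u v w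
  rotate {u} {v} {w} (weights {a} {b} {c} qa qb qc eq , total≉0) =
    weights qc qa qb (trans (reflexive (shift (a * v) (b * w) (c * u))) eq) ,
    λ nc t≈0 → total≉0 (λ (v≈w , w≈u) → nc (sym (trans v≈w w≈u) , v≈w))
                       (trans (reflexive (≡.sym (shift a b c))) t≈0)
    where
    shift : ∀ x y z → z + x + y ≡ x + y + z
    shift = solve 3 (λ x y z → z :+ x :+ y := x :+ y :+ z) ≡.refl

  negate : ∀ {u v w} → Solvable (- u) (- v) (- w) → Solvable u v w
  negate {u} {v} {w} (weights {a} {b} {c} qa qb qc eq , total≉0) =
    weights qa qb qc (linear₁ (- 1#) eq (lemma a b c u v w)) ,
    λ nc → total≉0 (λ (u≈v , v≈w) → nc (-‿cancel u≈v , -‿cancel v≈w))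
    where
    lemma : ∀ a b c u v w → a * u + b * v + c * w - 0# ≡ - 1# * (a * - u + b * - v + c * - w - 0#)
    lemma = solve 6 (λ a b c u v w → a :* u :+ b :* v :+ c :* w :- con 0# :=
      con (- 1#) :* (a :* (:- u) :+ b :* (:- v) :+ c :* (:- w) :- con 0#)) ≡.refl
    -‿cancel : ∀ {x y} → - x ≈ - y → x ≈ y
    -‿cancel {x} {y} e = linear₁ (- 1#) e (solve 2 (λ x y → x :- y := con (- 1#) :* (:- x :- :- y)) ≡.refl x y)

  -- Coefficients with sum zero become annihilating weights once each is divided by its term.
  rescale : ∀ {β₁ β₂ β₃ v₁ v₂ v₃ w₁ w₂ w₃} → v₁ * w₁ ≈ 1# → v₂ * w₂ ≈ 1# → v₃ * w₃ ≈ 1# →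
            β₁ + β₂ + β₃ ≈ 0# → (β₁ * w₁) * v₁ + (β₂ * w₂) * v₂ + (β₃ * w₃) * v₃ ≈ 0#
  rescale {β₁} {β₂} {β₃} {v₁} {v₂} {v₃} {w₁} {w₂} {w₃} i₁ i₂ i₃ β≈0 =
    trans (+-cong (+-cong (cancel β₁ i₁) (cancel β₂ i₂)) (cancel β₃ i₃)) β≈0
    where
    cancel : ∀ β {v w} → v * w ≈ 1# → (β * w) * v ≈ β
    cancel β {v} {w} vw≈1 = linear₁ β vw≈1
      (solve 3 (λ β v w → (β :* w) :* v :- β := β :* (v :* w :- con 1#)) ≡.refl β v w)

  -- The two totals differ by (α - β)(w₁ - w₂), which is nonzero by integrality.
  swap-total : ∀ {α β w₁ w₂ z} → α ≉ β → w₁ ≉ w₂ →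
               α * w₁ + β * w₂ + z ≈ 0# → β * w₁ + α * w₂ + z ≉ 0#
  swap-total {α} {β} {w₁} {w₂} {z} α≉β w₁≉w₂ t≈0 t′≈0 =
    [ α≉β ∘ x-y≈0⇒x≈y , w₁≉w₂ ∘ x-y≈0⇒x≈y ]′
      (integral {α - β} {w₁ - w₂} (linear₂ 1# (- 1#) t≈0 t′≈0 (lemma α β w₁ w₂ z)))
    where
    lemma : ∀ α β w₁ w₂ z → (α - β) * (w₁ - w₂) - 0# ≡
      1# * (α * w₁ + β * w₂ + z - 0#) + - 1# * (β * w₁ + α * w₂ + z - 0#)
    lemma = solve 5 (λ α β w₁ w₂ z → (α :- β) :* (w₁ :- w₂) :- con 0# :=
      con 1# :* (α :* w₁ :+ β :* w₂ :+ z :- con 0#) :+ con (- 1#) :* (β :* w₁ :+ α :* w₂ :+ z :- con 0#)) ≡.refl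

  inverse-≉ : ∀ {v₁ v₂ w₁ w₂} → v₁ * w₁ ≈ 1# → v₂ * w₂ ≈ 1# → v₁ ≉ v₂ → w₁ ≉ w₂
  inverse-≉ {v₁} {v₂} {w₁} {w₂} i₁ i₂ v₁≉v₂ w₁≈w₂ = v₁≉v₂ (begin
    v₁             ≈⟨ *-identityʳ v₁ ⟨
    v₁ * 1#        ≈⟨ *-congˡ {v₁} i₂ ⟨
    v₁ * (v₂ * w₂) ≡⟨ solve 3 (λ x y z → x :* (y :* z) := y :* (x :* z)) ≡.refl v₁ v₂ w₂ ⟩
    v₂ * (v₁ * w₂) ≈⟨ *-congˡ {v₂} (*-congˡ {v₁} w₁≈w₂) ⟨
    v₂ * (v₁ * w₁) ≈⟨ *-congˡ {v₂} i₁ ⟩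
    v₂ * 1#        ≈⟨ *-identityʳ v₂ ⟩
    v₂             ∎)
    where open import Relation.Binary.Reasoning.Setoid setoid

  -- Exchanging β₁ and β₂ yields a second solution, and the two totals do not
  -- both vanish.
  exchange : ∀ {β₁ β₂ β₃ v₁ v₂ v₃ w₁ w₂ w₃} → Q p β₁ → Q p β₂ → Q p w₁ → Q p w₂ → Q p (β₃ * w₃) →
             v₁ * w₁ ≈ 1# → v₂ * w₂ ≈ 1# → v₃ * w₃ ≈ 1# →
             β₁ + β₂ + β₃ ≈ 0# → β₁ ≉ β₂ → v₁ ≉ v₂ → Σ[ w ∈ Weights v₁ v₂ v₃ ] total w ≉ 0#
  exchange {β₁} {β₂} {β₃} {v₁} {v₂} {v₃} {w₁} {w₂} {w₃} q₁ q₂ qw₁ qw₂ q₃ i₁ i₂ i₃ β≈0 β₁≉β₂ v₁≉v₂ =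
    choose (β₁ * w₁ + β₂ * w₂ + β₃ * w₃ ≈? 0#)
    where
    choose : Dec (β₁ * w₁ + β₂ * w₂ + β₃ * w₃ ≈ 0#) → Σ[ w ∈ Weights v₁ v₂ v₃ ] total w ≉ 0#
    choose (no t≉0)  =
      weights (Q-* q₁ qw₁) (Q-* q₂ qw₂) q₃
        (rescale {β₁} {β₂} {β₃} {v₁} {v₂} {v₃} {w₁} {w₂} {w₃} i₁ i₂ i₃ β≈0) , t≉0
    choose (yes t≈0) =
      weights (Q-* q₂ qw₁) (Q-* q₁ qw₂) q₃
        (rescale {β₂} {β₁} {β₃} {v₁} {v₂} {v₃} {w₁} {w₂} {w₃} i₁ i₂ i₃ (trans (+-congʳ {β₃} (+-comm β₂ β₁)) β≈0)) ,
      swap-total {β₁} {β₂} {w₁} {w₂} {β₃ * w₃} β₁≉β₂ (inverse-≉ i₁ i₂ v₁≉v₂) t≈0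

  Inverse : Carrier → Set
  Inverse a = ∃[ b ] Q p b × a * b ≈ 1#

  -- Inverses of residues are residues, so rescaling a zero sum of three residues gives residue
  -- weights. The exchange is made at a pair of unequal terms, found after a rotation if necessary.
  same-sign : ∀ {u v w} → Q p u → Q p v → Q p w → Solvable u v w
  same-sign {u} {v} {w} qu qv qw = go (Q-balanced 3≉0) (Q-inverse qu) (Q-inverse qv) (Q-inverse qw) (u ≈? v) (v ≈? w)
    where
    go : ZeroSumOfResidues → Inverse u → Inverse v → Inverse w → Dec (u ≈ v) → Dec (v ≈ w) → Solvable u v w
    go (residues {α} {β} {γ} qα qβ qγ α+β+γ≈0 α≉β) (u′ , qu′ , iu) (v′ , qv′ , iv) (w′ , qw′ , iw) = split
      where
      split : Dec (u ≈ v) → Dec (v ≈ w) → Solvable u v w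
      split (no u≉v) _ =
        map₂ const (exchange {α} {β} {γ} {u} {v} {w} {u′} {v′} {w′}
          qα qβ qu′ qv′ (Q-* qγ qw′) iu iv iw α+β+γ≈0 α≉β u≉v)
      split (yes _) (no v≉w) = rotate
        (map₂ const (exchange {α} {β} {γ} {v} {w} {u} {v′} {w′} {u′}
          qα qβ qv′ qw′ (Q-* qγ qu′) iv iw iu α+β+γ≈0 α≉β v≉w))
      split (yes u≈v) (yes v≈w) =
        weights (Q-* qα qu′) (Q-* qβ qv′) (Q-* qγ qw′)
          (rescale {α} {β} {γ} {u} {v} {w} {u′} {v′} {w′} iu iv iw α+β+γ≈0) ,
        λ nc → contradiction (u≈v , v≈w) nc

  -- 3² + 4² = 5².
  mixed-sign : ∀ {u v w} → Q p u → Q p v → Q p (- w) → Solvable u v w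
  mixed-sign {u} {v} {w} qu qv q-w = go (Q-inverse qu) (Q-inverse qv) (Q-inverse q-w) (u ≈? v)
    where
    -- The difference is 7, so the exchange of 9 and 16 has an effect because p is not 7.
    9≉16 : + 9 ≉ + 16
    9≉16 e = 7≉0 (linear₁ (- 1#) e ≡.refl)
    go : Inverse u → Inverse v → Inverse (- w) → Dec (u ≈ v) → Solvable u v w
    go (u′ , qu′ , iu) (v′ , qv′ , iv) (w′ , qw′ , iw) = split
      where
      iw′ : w * - w′ ≈ 1#
      iw′ = trans (reflexive (solve 2 (λ w w′ → w :* (:- w′) := (:- w) :* w′) ≡.refl w w′)) iw
      -- The coefficient -25 and the inverse `- w′` of `w` are both negatives of residues, so the
      -- signs cancel.
      q₃ : Q p (- (+ 25) * - w′)
      q₃ = Q-resp (reflexive (solve 1 (λ w → con (+ 25) :* w := con (- (+ 25)) :* (:- w)) ≡.refl w′)) (Q-* Q-25 qw′)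
      u′≈v′ : u ≈ v → u′ ≈ v′
      u′≈v′ u≈v = *-cancelˡ {u} (Q⇒≉0 qu) (trans iu (sym (trans (*-congʳ {v′} u≈v) iv)))
      lemma : ∀ u v w → + 25 * u + + 25 * w - 0# ≡
        1# * (+ 9 * u + + 16 * v + - (+ 25) * - w - 0#) + + 16 * (u - v)
      lemma = solve 3 (λ u v w → con (+ 25) :* u :+ con (+ 25) :* w :- con 0# :=
        con 1# :* (con (+ 9) :* u :+ con (+ 16) :* v :+ con (- (+ 25)) :* (:- w) :- con 0#) :+ con (+ 16) :* (u :- v)) ≡.refl
      split : Dec (u ≈ v) → Solvable u v w
      split (no u≉v) = map₂ const
        (exchange {+ 9} {+ 16} { - (+ 25)} {u} {v} {w} {u′} {v′} { - w′} Q-9 Q-16 qu′ qv′ q₃ iu iv iw′ refl 9≉16 u≉v)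
      split (yes u≈v) =
        weights (Q-* Q-9 qu′) (Q-* Q-16 qv′) q₃
          (rescale {+ 9} {+ 16} { - (+ 25)} {u} {v} {w} {u′} {v′} { - w′} iu iv iw′ refl) ,
        -- For u = v the weights 9 and 16 merge, and the total becomes 25/u + 25/(-w), a sum of two
        -- residues.
        λ _ t≈0 → Q+Q≉0 {+ 25 * u′} {+ 25 * w′} (Q-* Q-25 qu′) (Q-* Q-25 qw′)
          (linear₂ 1# (+ 16) t≈0 (u′≈v′ u≈v) (lemma u′ v′ w′))

  -- Rotations and a common change of sign reduce the eight sign patterns to two: three residues, or
  -- two residues followed by the negative of one.
  solvable : ∀ {u v w} → u ≉ 0# → v ≉ 0# → w ≉ 0# → Solvable u v w
  solvable u≉0 v≉0 w≉0 = signs (±Q u≉0) (±Q v≉0) (±Q w≉0)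
    where
    neg-neg : ∀ {x} → Q p x → Q p (- - x)
    neg-neg {x} = Q-resp (reflexive (≡.sym (ℤ.neg-involutive x)))
    signs : ∀ {u v w} → Q p u ⊎ Q p (- u) → Q p v ⊎ Q p (- v) → Q p w ⊎ Q p (- w) → Solvable u v w
    signs (inj₁ a) (inj₁ b) (inj₁ c) = same-sign a b c
    signs (inj₁ a) (inj₁ b) (inj₂ c) = mixed-sign a b c
    signs (inj₁ a) (inj₂ b) (inj₁ c) = rotate (rotate (mixed-sign c a b))
    signs (inj₂ a) (inj₁ b) (inj₁ c) = rotate (mixed-sign b c a)
    signs (inj₂ a) (inj₂ b) (inj₂ c) = negate (same-sign a b c)
    signs (inj₂ a) (inj₂ b) (inj₁ c) = negate (mixed-sign a b (neg-neg c))
    signs (inj₂ a) (inj₁ b) (inj₂ c) = rotate (rotate (negate (mixed-sign c a (neg-neg b))))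
    signs (inj₁ a) (inj₂ b) (inj₂ c) = rotate (negate (mixed-sign b c (neg-neg a)))

  Represents₂ : (u v t : Carrier) → Set
  Represents₂ u v t = ∃[ a ] ∃[ b ] Q p a × Q p b × a * u + b * v ≈ t

  Represents₃ : (u v w t : Carrier) → Set
  Represents₃ u v w t = ∃[ a ] ∃[ b ] ∃[ c ] Q p a × Q p b × Q p c × a * u + b * v + c * w ≈ t

  -- Annihilate u, v and -t, then divide by the weight of -t.
  represent₂ : ∀ {u v} t → u ≉ 0# → v ≉ 0# → t ≉ 0# → Represents₂ u v t
  represent₂ {u} {v} t u≉0 v≉0 t≉0 = divide (proj₁ (solvable u≉0 v≉0 (-≉0 t≉0)))
    where
    lemma : ∀ a b c d u v t → a * d * u + b * d * v - t ≡ d * (a * u + b * v + c * - t - 0#) + t * (c * d - 1#)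
    lemma = solve 7 (λ a b c d u v t → a :* d :* u :+ b :* d :* v :- t :=
      d :* (a :* u :+ b :* v :+ c :* (:- t) :- con 0#) :+ t :* (c :* d :- con 1#)) ≡.refl
    divide : Weights u v (- t) → Represents₂ u v t
    divide (weights {a} {b} {c} qa qb qc eq) = by (Q-inverse qc)
      where
      by : ∃[ d ] Q p d × c * d ≈ 1# → Represents₂ u v t
      by (d , qd , cd≈1) = a * d , b * d , Q-* qa qd , Q-* qb qd , linear₂ d t eq cd≈1 (lemma a b c d u v t)

  -- Give w the weight 1 or 4, whichever leaves a nonzero remainder for the other two terms; both
  -- fail only if 3w = 0. The target may be zero here.
  represent₃ : ∀ {u v w} t → u ≉ 0# → v ≉ 0# → w ≉ 0# → Represents₃ u v w t
  represent₃ {u} {v} {w} t u≉0 v≉0 w≉0 = choose (t - 1# * w ≈? 0#)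
    where
    lemma₁ : ∀ x y z t → x + y + z - t ≡ 1# * (x + y - (t - z))
    lemma₁ = solve 4 (λ x y z t → x :+ y :+ z :- t := con 1# :* (x :+ y :- (t :- z))) ≡.refl
    lemma₂ : ∀ t w → + 3 * w - 0# ≡ 1# * (t - 1# * w - 0#) + - 1# * (t - + 4 * w - 0#)
    lemma₂ = solve 2 (λ t w → con (+ 3) :* w :- con 0# :=
      con 1# :* (t :- con 1# :* w :- con 0#) :+ con (- 1#) :* (t :- con (+ 4) :* w :- con 0#)) ≡.refl
    extend : ∀ {c} → Q p c → Represents₂ u v (t - c * w) → Represents₃ u v w t
    extend {c} qc (a , b , qa , qb , eq) = a , b , c , qa , qb , qc , linear₁ 1# eq (lemma₁ (a * u) (b * v) (c * w) t)
    choose : Dec (t - 1# * w ≈ 0#) → Represents₃ u v w t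
    choose (no e≉0)  = extend Q-1 (represent₂ (t - 1# * w) u≉0 v≉0 e≉0)
    choose (yes e≈0) = extend Q-4 (represent₂ (t - + 4 * w) u≉0 v≉0 λ e′≈0 →
      *-≉0 {+ 3} {w} 3≉0 w≉0 (linear₂ 1# (- 1#) e≈0 e′≈0 (lemma₂ t w)))

-- Translation, change of a single weight, and consecutive blocks.

module Windows (p : ℕ) where
  open Mod p

  ∑-translate : ∀ {n} (a x : Vector Carrier n) c →
    ∑[ i < n ] (a i * x i) ≡ ∑[ i < n ] (a i * (x i - c)) + c * ∑[ i < n ] a i
  ∑-translate {zero}  a x c = solve 1 (λ c → con 0# := con 0# :+ c :* con 0#) ≡.refl c
  ∑-translate {suc n} a x c = ≡.trans (≡.cong (λ s → a 0F * x 0F + s) (∑-translate (tail a) (tail x) c))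
    (lemma (a 0F) (x 0F) c _ _)
    where
    lemma : ∀ a x c s t → a * x + (s + c * t) ≡ a * (x - c) + s + c * (a + t)
    lemma = solve 5 (λ a x c s t → a :* x :+ (s :+ c :* t) := a :* (x :- c) :+ s :+ c :* (a :+ t)) ≡.refl

  -- A constant shift changes the weighted sum by a multiple of the total weight, which is zero.
  translate : ∀ {n} (x : Vector Carrier n) c → IsQ1WeightedZeroSum p (λ i → x i - c) → IsQ1WeightedZeroSum p x
  translate {n} x c (a , qa , ax≈0 , a≈0) = a , qa ,
    trans (reflexive (∑-translate a x c))
      (linear₂ 1# c ax≈0 a≈0 (lemma (∑[ i < n ] (a i * (x i - c))) (∑[ i < n ] a i) c)) , a≈0
    where
    lemma : ∀ s t c → s + c * t - 0# ≡ 1# * (s - 0#) + c * (t - 0#)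
    lemma = solve 3 (λ s t c → s :+ c :* t :- con 0# := con 1# :* (s :- con 0#) :+ c :* (t :- con 0#)) ≡.refl

  ∑-updateAt : ∀ {n} (a x : Vector Carrier n) i c →
    ∑[ l < n ] (updateAt a i (const c) l * x l) ≡ ∑[ l < n ] (a l * x l) + (c - a i) * x i
  ∑-updateAt {suc n} a x 0F      c = lemma (a 0F) (x 0F) c _
    where
    lemma : ∀ a x c s → c * x + s ≡ a * x + s + (c - a) * x
    lemma = solve 4 (λ a x c s → c :* x :+ s := a :* x :+ s :+ (c :- a) :* x) ≡.refl
  ∑-updateAt {suc n} a x (suc i) c = ≡.trans (≡.cong (λ s → a 0F * x 0F + s) (∑-updateAt (tail a) (tail x) i c))
    (≡.sym (ℤ.+-assoc (a 0F * x 0F) _ _))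

  -- `s` terms are skipped before the window and `r` after it.
  window : ∀ s {m} r (x : Vector Carrier (s ℕ.+ (suc m ℕ.+ r))) →
           IsQ1WeightedZeroSum p (λ (j : Fin (suc m)) → x (s ↑ʳ (j ↑ˡ r))) → HasConsecutiveQ1ZeroSum p x
  window s {m} r x wzs = m , (λ j → s ↑ʳ (j ↑ˡ r)) ,
    (s , λ j → ≡.trans (Fin.toℕ-↑ʳ s (j ↑ˡ r)) (≡.cong (s ℕ.+_) (Fin.toℕ-↑ˡ j r))) , wzs

  -- `combine b` enumerates the positions 3b, 3b + 1, 3b + 2.
  block : (b : Fin 3) (x : Vector Carrier 9) → IsQ1WeightedZeroSum p (λ (j : Fin 3) → x (combine b j)) →
          HasConsecutiveQ1ZeroSum p x
  block b x wzs = 2 , combine b , (3 ℕ.* toℕ b , Fin.toℕ-combine b) , wzs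

updateAt-all : ∀ {n} {A : Set} (P : A → Set) {a : Vector A n} {c} i → P c → (∀ l → P (a l)) →
               ∀ l → P (updateAt a i (const c) l)
updateAt-all P 0F      pc pa 0F      = pc
updateAt-all P 0F      pc pa (suc l) = pa (suc l)
updateAt-all P (suc i) pc pa 0F      = pa 0F
updateAt-all P (suc i) pc pa (suc l) = updateAt-all P i pc (pa ∘ suc) l

-- Upper bound for p other than 3 and 7.

module UpperBound {p h k : ℕ} (pr : Prime p) (p%4≡3 : p % 4 ≡ 3)
  (p≡1+2h : p ≡ suc (h ℕ.+ h)) (h≡1+2k : h ≡ suc (k ℕ.+ k))
  (p≢3 : p ≢ 3) (p≢7 : p ≢ 7) where
  open Large {p} {h} {k} pr p%4≡3 p≡1+2h h≡1+2k p≢3 p≢7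
  open Windows p

  Adjusted : ∀ {n} (x b : Vector Carrier n) (i j k : Fin n) (t : Carrier) → Set
  Adjusted {n} x b i j k t = Σ[ a ∈ Vector Carrier n ] (∀ l → Q p (a l)) × ∑[ l < n ] (a l * x l) ≈ t ×
    (∀ l → l ≢ i → l ≢ j → l ≢ k → a l ≡ b l)

  -- By `represent₃`, the weights at three nonzero terms alone steer the weighted sum to any target.
  adjust : ∀ {n} (x b : Vector Carrier n) {i j k} → i ≢ j → i ≢ k → j ≢ k →
           x i ≉ 0# → x j ≉ 0# → x k ≉ 0# → (∀ l → Q p (b l)) → ∀ t → Adjusted x b i j k t
  adjust {n} x b {i} {j} {k} i≢j i≢k j≢k xi≉0 xj≉0 xk≉0 qb t = go (represent₃ _ xi≉0 xj≉0 xk≉0)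
    where
    s = ∑[ l < n ] (b l * x l)
    -- The three new weights must contribute `t` minus the part of `s` that comes from the other
    -- positions.
    go : Represents₃ (x i) (x j) (x k) (t - s + b i * x i + b j * x j + b k * x k) → Adjusted x b i j k t
    go (c₁ , c₂ , c₃ , q₁ , q₂ , q₃ , eq) = b₃ ,
      updateAt-all (Q p) k q₃ (updateAt-all (Q p) j q₂ (updateAt-all (Q p) i q₁ qb)) ,
      trans (reflexive total) (linear₁ 1# eq (lemma s t (b i) (b j) (b k) c₁ c₂ c₃ (x i) (x j) (x k))) ,
      λ l l≢i l≢j l≢k → ≡.trans (updateAt-minimal l k b₂ l≢k)
        (≡.trans (updateAt-minimal l j b₁ l≢j) (updateAt-minimal l i b l≢i))
      where
      b₁ b₂ b₃ : Vector Carrier n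
      b₁ = updateAt b  i (const c₁)
      b₂ = updateAt b₁ j (const c₂)
      b₃ = updateAt b₂ k (const c₃)
      b₁j : b₁ j ≡ b j
      b₁j = updateAt-minimal j i b (i≢j ∘ ≡.sym)
      b₂k : b₂ k ≡ b k
      b₂k = ≡.trans (updateAt-minimal k j b₁ (j≢k ∘ ≡.sym)) (updateAt-minimal k i b (i≢k ∘ ≡.sym))
      total : ∑[ l < n ] (b₃ l * x l) ≡ s + (c₁ - b i) * x i + (c₂ - b j) * x j + (c₃ - b k) * x k
      total = ≡.trans (∑-updateAt b₂ x k c₃) (≡.cong₂ (λ u v → u + (c₃ - v) * x k)
        (≡.trans (∑-updateAt b₁ x j c₂) (≡.cong₂ (λ u v → u + (c₂ - v) * x j) (∑-updateAt b x i c₁) b₁j)) b₂k)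
      lemma : ∀ s t b₁ b₂ b₃ c₁ c₂ c₃ x y z →
        s + (c₁ - b₁) * x + (c₂ - b₂) * y + (c₃ - b₃) * z - t ≡
        1# * (c₁ * x + c₂ * y + c₃ * z - (t - s + b₁ * x + b₂ * y + b₃ * z))
      lemma = solve 11 (λ s t b₁ b₂ b₃ c₁ c₂ c₃ x y z →
        s :+ (c₁ :- b₁) :* x :+ (c₂ :- b₂) :* y :+ (c₃ :- b₃) :* z :- t :=
        con 1# :* (c₁ :* x :+ c₂ :* y :+ c₃ :* z :- (t :- s :+ b₁ :* x :+ b₂ :* y :+ b₃ :* z))) ≡.refl

  -- Weights at the nonzero terms make the weighted sum vanish, after which weights
  -- at the zero terms can be chosen freely to make the total weight vanish.
  spread : ∀ {n} (x : Vector Carrier n) {i j k i′ j′ k′} →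
           i ≢ j → i ≢ k → j ≢ k → x i ≈ 0# → x j ≈ 0# → x k ≈ 0# →
           i′ ≢ j′ → i′ ≢ k′ → j′ ≢ k′ → x i′ ≉ 0# → x j′ ≉ 0# → x k′ ≉ 0# → IsQ1WeightedZeroSum p x
  spread {n} x {i} {j} {k} i≢j i≢k j≢k xi≈0 xj≈0 xk≈0 i′≢j′ i′≢k′ j′≢k′ xi′≉0 xj′≉0 xk′≉0 =
    first (adjust x (const 1#) i′≢j′ i′≢k′ j′≢k′ xi′≉0 xj′≉0 xk′≉0 (const Q-1) 0#)
    where
    first : Adjusted x (const 1#) _ _ _ 0# → IsQ1WeightedZeroSum p x
    -- For the constant sequence 1 the weighted sum is the total weight.
    first (a , qa , ax≈0 , _) = second (adjust (const 1#) a i≢j i≢k j≢k 1≉0 1≉0 1≉0 qa 0#)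
      where
      second : Adjusted (const 1#) a i j k 0# → IsQ1WeightedZeroSum p x
      second (b , qb , b1≈0 , b≗a) = b , qb ,
        trans (sum-cong-≋ (λ l → agree l (l Fin.≟ i) (l Fin.≟ j) (l Fin.≟ k))) ax≈0 ,
        trans (sum-cong-≋ (λ l → sym (*-identityʳ (b l)))) b1≈0
        where
        at-zero : ∀ l → x l ≈ 0# → b l * x l ≈ a l * x l
        at-zero l xl≈0 = trans (trans (*-congˡ {b l} xl≈0) (zeroʳ (b l))) (sym (trans (*-congˡ {a l} xl≈0) (zeroʳ (a l))))
        agree : ∀ l → Dec (l ≡ i) → Dec (l ≡ j) → Dec (l ≡ k) → b l * x l ≈ a l * x l
        agree l (yes ≡.refl) _ _ = at-zero l xi≈0
        agree l (no _) (yes ≡.refl) _ = at-zero l xj≈0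
        agree l (no _) (no _) (yes ≡.refl) = at-zero l xk≈0
        agree l (no l≢i) (no l≢j) (no l≢k) = reflexive (≡.cong (λ c → c * x l) (b≗a l l≢i l≢j l≢k))

  -- After translation by c every term vanishes, and it remains to write 0 as a sum of three
  -- residues.
  constant : (x : Vector Carrier 3) (c : Carrier) → (∀ i → x i ≈ c) → IsQ1WeightedZeroSum p x
  constant x c x≈c = translate x c (go (represent₃ 0# 1≉0 1≉0 1≉0))
    where
    x-c≈0 : ∀ i → x i - c ≈ 0#
    x-c≈0 i = linear₁ 1# (x≈c i) (solve 2 (λ x c → x :- c :- con 0# := con 1# :* (x :- c)) ≡.refl (x i) c)
    lemma : ∀ a₁ a₂ a₃ → a₁ + (a₂ + (a₃ + 0#)) ≡ a₁ * 1# + a₂ * 1# + a₃ * 1#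
    lemma = solve 3 (λ a₁ a₂ a₃ → a₁ :+ (a₂ :+ (a₃ :+ con 0#)) := a₁ :* con 1# :+ a₂ :* con 1# :+ a₃ :* con 1#) ≡.refl
    go : Represents₃ 1# 1# 1# 0# → IsQ1WeightedZeroSum p (λ i → x i - c)
    go (a₁ , a₂ , a₃ , q₁ , q₂ , q₃ , eq) = a , (λ { 0F → q₁ ; 1F → q₂ ; 2F → q₃ }) ,
      trans (sum-cong-≋ (λ i → trans (*-congˡ {a i} (x-c≈0 i)) (zeroʳ (a i)))) (sum-replicate-zero 3) ,
      trans (reflexive (lemma a₁ a₂ a₃)) eq
      where
      a : Vector Carrier 3
      a = a₁ ∷ a₂ ∷ a₃ ∷ []
  NoTriple : ∀ {n} → Vector Carrier n → Set
  NoTriple x = ∀ {i j k} → i ≢ j → i ≢ k → j ≢ k → ¬ (x i ≈ x j × x j ≈ x k)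

  NoTriple-∘ : ∀ {m n} {x : Vector Carrier n} (f : Fin m → Fin n) → (∀ {i j} → f i ≡ f j → i ≡ j) →
               NoTriple x → NoTriple (x ∘ f)
  NoTriple-∘ f inj nt i≢j i≢k j≢k = nt (i≢j ∘ inj) (i≢k ∘ inj) (j≢k ∘ inj)

  Prescribed : (x : Vector Carrier 6) (t : Carrier) → Set
  Prescribed x t = Σ[ a ∈ Vector Carrier 6 ] (∀ i → Q p (a i)) × ∑[ i < 6 ] (a i * x i) ≈ 0# × ∑[ i < 6 ] a i ≈ t

  -- Each half of x is annihilated by weights with nonzero total; scaling the two
  -- halves independently produces any nonzero total.
  prescribe : (z : Vector Carrier 6) (c : Carrier) → (∀ i → z i ≉ c) → NoTriple z →
              ∀ {t} → t ≉ 0# → Prescribed (λ i → z i - c) t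
  prescribe z c z≉c nt {t} t≉0 =
    go (solvable (y≉0 0F) (y≉0 1F) (y≉0 2F)) (solvable (y≉0 3F) (y≉0 4F) (y≉0 5F))
    where
    y : Vector Carrier 6
    y i = z i - c
    y≉0 : ∀ i → y i ≉ 0#
    y≉0 i = z≉c i ∘ x-y≈0⇒x≈y
    y-injective : ∀ i j → y i ≈ y j → z i ≈ z j
    y-injective i j e = linear₁ 1# e (solve 3 (λ u v c → u :- v := con 1# :* (u :- c :- (v :- c))) ≡.refl (z i) (z j) c)
    lemma₁ : ∀ q r a₁ a₂ a₃ b₁ b₂ b₃ y₁ y₂ y₃ z₁ z₂ z₃ →
      q * a₁ * y₁ + (q * a₂ * y₂ + (q * a₃ * y₃ + (r * b₁ * z₁ + (r * b₂ * z₂ + (r * b₃ * z₃ + 0#))))) - 0# ≡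
      q * (a₁ * y₁ + a₂ * y₂ + a₃ * y₃ - 0#) + r * (b₁ * z₁ + b₂ * z₂ + b₃ * z₃ - 0#)
    lemma₁ = solve 14 (λ q r a₁ a₂ a₃ b₁ b₂ b₃ y₁ y₂ y₃ z₁ z₂ z₃ →
      q :* a₁ :* y₁ :+ (q :* a₂ :* y₂ :+ (q :* a₃ :* y₃ :+ (r :* b₁ :* z₁ :+ (r :* b₂ :* z₂ :+ (r :* b₃ :* z₃ :+ con 0#))))) :- con 0# :=
      q :* (a₁ :* y₁ :+ a₂ :* y₂ :+ a₃ :* y₃ :- con 0#) :+ r :* (b₁ :* z₁ :+ b₂ :* z₂ :+ b₃ :* z₃ :- con 0#)) ≡.refl
    lemma₂ : ∀ q r a₁ a₂ a₃ b₁ b₂ b₃ →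
      q * a₁ + (q * a₂ + (q * a₃ + (r * b₁ + (r * b₂ + (r * b₃ + 0#))))) ≡ q * (a₁ + a₂ + a₃) + r * (b₁ + b₂ + b₃)
    lemma₂ = solve 8 (λ q r a₁ a₂ a₃ b₁ b₂ b₃ →
      q :* a₁ :+ (q :* a₂ :+ (q :* a₃ :+ (r :* b₁ :+ (r :* b₂ :+ (r :* b₃ :+ con 0#))))) :=
      q :* (a₁ :+ a₂ :+ a₃) :+ r :* (b₁ :+ b₂ :+ b₃)) ≡.refl
    go : Solvable (y 0F) (y 1F) (y 2F) → Solvable (y 3F) (y 4F) (y 5F) → Prescribed y t
    go (weights {a₁} {a₂} {a₃} qa₁ qa₂ qa₃ ay≈0 , a≉0) (weights {b₁} {b₂} {b₃} qb₁ qb₂ qb₃ by≈0 , b≉0) =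
      -- Without a triple neither half is constant, so both totals are nonzero.
      combined (represent₂ t
        (a≉0 λ (e , f) → nt (λ ()) (λ ()) (λ ()) (y-injective 0F 1F e , y-injective 1F 2F f))
        (b≉0 λ (e , f) → nt (λ ()) (λ ()) (λ ()) (y-injective 3F 4F e , y-injective 4F 5F f)) t≉0)
      where
      combined : Represents₂ (a₁ + a₂ + a₃) (b₁ + b₂ + b₃) t → Prescribed y t
      combined (q , r , qq , qr , eq) =
        (q * a₁) ∷ (q * a₂) ∷ (q * a₃) ∷ (r * b₁) ∷ (r * b₂) ∷ (r * b₃) ∷ [] ,
        (λ { 0F → Q-* qq qa₁ ; 1F → Q-* qq qa₂ ; 2F → Q-* qq qa₃
           ; 3F → Q-* qr qb₁ ; 4F → Q-* qr qb₂ ; 5F → Q-* qr qb₃ }) ,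
        linear₂ q r ay≈0 by≈0 (lemma₁ q r a₁ a₂ a₃ b₁ b₂ b₃ (y 0F) (y 1F) (y 2F) (y 3F) (y 4F) (y 5F)) ,
        trans (reflexive (lemma₂ q r a₁ a₂ a₃ b₁ b₂ b₃)) eq

  -- After translation the head is 0; its weight 1 compensates a total of -1 on the other six terms.
  unique-head : (z : Vector Carrier 7) → (∀ i → tail z i ≉ z 0F) → NoTriple z → IsQ1WeightedZeroSum p z
  unique-head z z≉z₀ nt = translate z (z 0F)
    (go (prescribe (tail z) (z 0F) z≉z₀ (NoTriple-∘ {x = z} suc Fin.suc-injective nt) { - 1# } (-≉0 1≉0)))
    where
    y : Vector Carrier 7
    y i = z i - z 0F
    lemma : ∀ z s → 1# * (z - z) + s ≡ s
    lemma = solve 2 (λ z s → con 1# :* (z :- z) :+ s := s) ≡.refl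
    go : Prescribed (tail y) (- 1#) → IsQ1WeightedZeroSum p y
    go (a , qa , ay≈0 , a≈-1) = 1# ∷ a , (λ { 0F → Q-1 ; (suc i) → qa i }) ,
      trans (reflexive (lemma (z 0F) (∑[ i < 6 ] (a i * tail y i)))) ay≈0 ,
      trans (+-congˡ {1#} a≈-1) refl

  -- After translation the head and its repetition vanish, so their weights 9 and 16 only affect the
  -- total and compensate -25 on the other six terms.
  repeated-head : (z : Vector Carrier 8) (j : Fin 7) → tail z j ≈ z 0F → NoTriple z → IsQ1WeightedZeroSum p z
  repeated-head z j zⱼ≈z₀ nt = translate z (z 0F)
    (go (prescribe (removeAt (tail z) j) (z 0F)
      (λ i zᵢ≈z₀ → nt {0F} {suc j} {suc (punchIn j i)} (λ ()) (λ ()) (Fin.punchInᵢ≢i j i ∘ ≡.sym ∘ Fin.suc-injective)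
        (sym zⱼ≈z₀ , trans zⱼ≈z₀ (sym zᵢ≈z₀)))
      (NoTriple-∘ {x = z} (suc ∘ punchIn j) (Fin.punchIn-injective j _ _ ∘ Fin.suc-injective) nt)
      { - (+ 25) } (-≉0 5²≉0)))
    where
    5²≉0 : + 25 ≉ 0#
    5²≉0 = Q⇒≉0 Q-25
    y : Vector Carrier 8
    y i = z i - z 0F
    lemma : ∀ z w s → + 9 * (z - z) + (+ 16 * (w - z) + s) - 0# ≡ + 16 * (w - z) + 1# * (s - 0#)
    lemma = solve 3 (λ z w s → con (+ 9) :* (z :- z) :+ (con (+ 16) :* (w :- z) :+ s) :- con 0# :=
      con (+ 16) :* (w :- z) :+ con 1# :* (s :- con 0#)) ≡.refl
    go : Prescribed (removeAt (tail y) j) (- (+ 25)) → IsQ1WeightedZeroSum p y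
    go (a , qa , ay≈0 , a≈-25) = + 9 ∷ b , (λ { 0F → Q-9 ; (suc i) → qb i }) ,
      trans (+-congˡ {+ 9 * y 0F} by) (linear₂ (+ 16) 1# zⱼ≈z₀ ay≈0 (lemma (z 0F) (tail z j) s)) ,
      trans (+-congˡ {+ 9} b≈-9) refl
      where
      b : Vector Carrier 7
      b = insertAt a j (+ 16)
      s = ∑[ i < 6 ] (a i * removeAt (tail y) j i)
      by : ∑[ i < 7 ] (b i * tail y i) ≈ + 16 * tail y j + s
      by = trans (sum-remove {i = j} (λ i → b i * tail y i))
        (+-cong (reflexive (≡.cong (λ c → c * tail y j) (insertAt-lookup a j (+ 16))))
                (sum-cong-≋ (λ i → reflexive (≡.cong (λ c → c * tail y (punchIn j i)) (insertAt-punchIn a j (+ 16) i)))))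
      b≈-9 : ∑[ i < 7 ] b i ≈ - (+ 9)
      b≈-9 = trans (sum-remove {i = j} b)
        (trans (+-cong (reflexive (insertAt-lookup a j (+ 16))) (sum-cong-≋ (λ i → reflexive (insertAt-punchIn a j (+ 16) i))))
        (trans (+-congˡ {+ 16} a≈-25) refl))
      qb : ∀ i → Q p (b i)
      qb i = at i (i Fin.≟ j)
        where
        at : ∀ i → Dec (i ≡ j) → Q p (b i)
        at i (yes ≡.refl) = ≡.subst (Q p) (≡.sym (insertAt-lookup a j (+ 16))) Q-16
        at i (no i≢j) = ≡.subst (Q p ∘ b) (Fin.punchIn-punchOut (i≢j ∘ ≡.sym))
          (≡.subst (Q p) (≡.sym (insertAt-punchIn a j (+ 16) (Fin.punchOut (i≢j ∘ ≡.sym)))) (qa _))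

  Triple : ∀ {n} → Vector Carrier n → Set
  Triple x = ∃[ i ] ∃[ j ] ∃[ k ] (i ≢ j × i ≢ k × j ≢ k) × x i ≈ x j × x j ≈ x k

  triple? : ∀ {n} (x : Vector Carrier n) → Dec (Triple x)
  triple? x = Fin.any? λ i → Fin.any? λ j → Fin.any? λ k →
    (¬? (i Fin.≟ j) ×-dec ¬? (i Fin.≟ k) ×-dec ¬? (j Fin.≟ k)) ×-dec (x i ≈? x j) ×-dec (x j ≈? x k)

  upper-bound : (x : Vector Carrier 9) → HasConsecutiveQ1ZeroSum p x
  upper-bound x = cases (triple? x)
    where
    z : Vector Carrier 8
    z i = x (i ↑ˡ 1)

    ↑ˡ-twice : (i : Fin 6) → i ↑ˡ 2 ≡ (i ↑ˡ 1) ↑ˡ 1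
    ↑ˡ-twice i = Fin.toℕ-injective (≡.trans (Fin.toℕ-↑ˡ i 2)
      (≡.sym (≡.trans (Fin.toℕ-↑ˡ (i ↑ˡ 1) 1) (Fin.toℕ-↑ˡ i 1))))

    -- Six terms different from the head are wanted: the first eight terms provide them if the head
    -- recurs there, and otherwise the first seven do.
    without-triple : NoTriple x → Dec (∃[ j ] tail z j ≈ z 0F) → HasConsecutiveQ1ZeroSum p x
    without-triple nt (yes (j , zⱼ≈z₀)) = window 0 1 x
      (repeated-head z j zⱼ≈z₀ (NoTriple-∘ {x = x} (_↑ˡ 1) (Fin.↑ˡ-injective 1 _ _) nt))
    without-triple nt (no ∄j) = window 0 2 x
      (unique-head (λ i → x (i ↑ˡ 2))
        (λ i e → ∄j (i ↑ˡ 1 , ≡.subst (λ l → x (suc l) ≈ z 0F) (↑ˡ-twice i) e))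
        (NoTriple-∘ {x = x} (_↑ˡ 2) (Fin.↑ˡ-injective 2 _ _) nt))

    cases : Dec (Triple x) → HasConsecutiveQ1ZeroSum p x
    cases (no ∄t) = without-triple (λ i≢j i≢k j≢k e → ∄t (_ , _ , _ , (i≢j , i≢k , j≢k) , e))
                                   (Fin.any? λ j → tail z j ≈? z 0F)
    cases (yes (i , j , k , (i≢j , i≢k , j≢k) , xi≈xj , xj≈xk)) = scan (other 0F) (other 1F) (other 2F)
      where
      c = x i
      Other : Fin 3 → Set
      Other b = ∃[ r ] x (combine b r) ≉ c
      other : ∀ b → Dec (Other b)
      other b = Fin.any? λ r → ¬? (x (combine b r) ≈? c)
      all-c : ∀ b → ¬ Other b → HasConsecutiveQ1ZeroSum p x
      all-c b ∄r = block b x (constant (x ∘ combine b) c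
        (λ r → decidable-stable (x (combine b r) ≈? c) (λ x≉c → ∄r (r , x≉c))))
      vanish : ∀ {l} → x l ≈ c → x l - c ≈ 0#
      vanish {l} e = linear₁ 1# e (solve 2 (λ x c → x :- c :- con 0# := con 1# :* (x :- c)) ≡.refl (x l) c)
      distinct : ∀ b b′ r r′ → b ≢ b′ → combine {3} {3} b r ≢ combine b′ r′
      distinct b b′ r r′ b≢b′ = b≢b′ ∘ Fin.combine-injectiveˡ b r b′ r′
      scan : Dec (Other 0F) → Dec (Other 1F) → Dec (Other 2F) → HasConsecutiveQ1ZeroSum p x
      scan (no ∄r) _ _ = all-c 0F ∄r
      scan (yes _) (no ∄r) _ = all-c 1F ∄r
      scan (yes _) (yes _) (no ∄r) = all-c 2F ∄r
      -- Lying in different blocks, the three terms other than c are at distinct positions, so the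
      -- whole sequence can be weighted.
      scan (yes (r₀ , ≉₀)) (yes (r₁ , ≉₁)) (yes (r₂ , ≉₂)) = window 0 0 x (translate x c
        (spread (λ l → x l - c) i≢j i≢k j≢k (vanish refl) (vanish (sym xi≈xj)) (vanish (sym (trans xi≈xj xj≈xk)))
          (distinct 0F 1F r₀ r₁ (λ ())) (distinct 0F 2F r₀ r₂ (λ ())) (distinct 1F 2F r₁ r₂ (λ ()))
          (≉₀ ∘ x-y≈0⇒x≈y) (≉₁ ∘ x-y≈0⇒x≈y) (≉₂ ∘ x-y≈0⇒x≈y)))

-- Upper bound for p = 3.

module PrimeThree where
  open PrimeField {3} (from-yes (prime? 3))
  open Windows 3

  unweighted : ∀ {n} (x : Vector Carrier n) → sum x ≈ 0# → ∑[ i < n ] 1# ≈ 0# → IsQ1WeightedZeroSum 3 x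
  unweighted x Σx≈0 Σ1≈0 = const 1# , const (1# , (1# , refl , refl) , refl) ,
    trans (sum-cong-≋ (*-identityˡ ∘ x)) Σx≈0 , Σ1≈0

  -- By Fermat's theorem x² = y² = 1 modulo 3, hence (x + y)(x - y) = 0.
  x+y≉0⇒x≈y : ∀ {x y} → x ≉ 0# → y ≉ 0# → x + y ≉ 0# → x ≈ y
  x+y≉0⇒x≈y {x} {y} x≉0 y≉0 x+y≉0 =
    [ (λ e → contradiction e x+y≉0) , x-y≈0⇒x≈y ]′
      (integral {x + y} {x - y} (linear₂ 1# (- 1#) (fermat x≉0) (fermat y≉0) (lemma x y)))
    where
    lemma : ∀ x y → (x + y) * (x - y) - 0# ≡ 1# * (x * (x * 1#) - 1#) + - 1# * (y * (y * 1#) - 1#)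
    lemma = solve 2 (λ x y → (x :+ y) :* (x :- y) :- con 0# :=
      con 1# :* (x :* (x :* con 1#) :- con 1#) :+ con (- 1#) :* (y :* (y :* con 1#) :- con 1#)) ≡.refl

  upper-bound : (x : Vector Carrier 9) → HasConsecutiveQ1ZeroSum 3 x
  upper-bound x = cases (A ≈? 0#) (B ≈? 0#) (C ≈? 0#) (A + B ≈? 0#) (B + C ≈? 0#)
    where
    A = sum (λ j → x (combine {3} {3} 0F j))
    B = sum (λ j → x (combine {3} {3} 1F j))
    C = sum (λ j → x (combine {3} {3} 2F j))
    append : ∀ a b c s → a + (b + (c + s)) ≡ a + (b + (c + 0#)) + s
    append = solve 4 (λ a b c s → a :+ (b :+ (c :+ s)) := a :+ (b :+ (c :+ con 0#)) :+ s) ≡.refl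
    cases : Dec (A ≈ 0#) → Dec (B ≈ 0#) → Dec (C ≈ 0#) → Dec (A + B ≈ 0#) → Dec (B + C ≈ 0#) → HasConsecutiveQ1ZeroSum 3 x
    cases (yes e) _ _ _ _ = block 0F x (unweighted (x ∘ combine {3} {3} 0F) e (∣⇒≈0 {3} (divides 1 ≡.refl)))
    cases (no _) (yes e) _ _ _ = block 1F x (unweighted (x ∘ combine {3} {3} 1F) e (∣⇒≈0 {3} (divides 1 ≡.refl)))
    cases (no _) (no _) (yes e) _ _ = block 2F x (unweighted (x ∘ combine {3} {3} 2F) e (∣⇒≈0 {3} (divides 1 ≡.refl)))
    cases (no _) (no _) (no _) (yes e) _ = window 0 {5} 3 x (unweighted (λ j → x (j ↑ˡ 3))
      (trans (reflexive (append (x 0F) (x 1F) (x 2F) B)) e) (∣⇒≈0 {6} (divides 2 ≡.refl)))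
    cases (no _) (no _) (no _) (no _) (yes e) = window 3 {5} 0 x (unweighted (λ j → x (3 ↑ʳ (j ↑ˡ 0)))
      (trans (reflexive (append (x 3F) (x 4F) (x 5F) C)) e) (∣⇒≈0 {6} (divides 2 ≡.refl)))
    -- Now A = B = C, so the sum of all nine terms is 3B = 0.
    cases (no A≉0) (no B≉0) (no C≉0) (no A+B≉0) (no B+C≉0) = window 0 {8} 0 x (unweighted (λ j → x (j ↑ˡ 0))
      (trans (reflexive (append (x 0F) (x 1F) (x 2F) (x 3F + (x 4F + (x 5F + C)))))
        (trans (+-congˡ {A} (reflexive (append (x 3F) (x 4F) (x 5F) C)))
        (trans (+-cong (x+y≉0⇒x≈y A≉0 B≉0 A+B≉0) (+-congˡ {B} (sym (x+y≉0⇒x≈y B≉0 C≉0 B+C≉0))))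
        (trans (reflexive (solve 1 (λ b → b :+ (b :+ b) := con (+ 3) :* b) ≡.refl B))
          (trans (*-congʳ {B} (∣⇒≈0 {3} (divides 1 ≡.refl))) (zeroˡ B))))))
      (∣⇒≈0 {9} (divides 3 ≡.refl)))

-- Lower bound: the sequence 0, 0, 1, 0, 0, 1, 0, 0.

count : ∀ {n} → (Fin n → Bool) → ℕ
count {zero}  f = 0
count {suc n} f = (if f 0F then suc else id) (count (f ∘ suc))

bit : ℕ → Bool
bit n = n % 3 ℕ.≡ᵇ 2

OneOrTwo : ℕ → Set
OneOrTwo n = n ≡ 1 ⊎ n ≡ 2

-- A finite check over all starts and lengths; `m` is the length minus one, and counting
-- `const true` gives the length.
short-or-few-ones : ∀ s m → s ℕ.+ m ℕ.< 8 →
  OneOrTwo (count {suc m} (λ i → bit (s ℕ.+ toℕ i))) ⊎ OneOrTwo (count {suc m} (const true))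
short-or-few-ones s m s+m<8 = ≡.subst₂ Claim (Fin.toℕ-fromℕ< s<8) (Fin.toℕ-fromℕ< m<8)
  (grid (fromℕ< s<8) (fromℕ< m<8)) s+m<8
  where
  s<8 : s ℕ.< 8
  s<8 = ℕ.≤-<-trans (ℕ.m≤m+n s m) s+m<8
  m<8 : m ℕ.< 8
  m<8 = ℕ.≤-<-trans (ℕ.m≤n+m m s) s+m<8
  Claim : ℕ → ℕ → Set
  Claim s m = s ℕ.+ m ℕ.< 8 →
    OneOrTwo (count {suc m} (λ i → bit (s ℕ.+ toℕ i))) ⊎ OneOrTwo (count {suc m} (const true))
  oneOrTwo? : ∀ n → Dec (OneOrTwo n)
  oneOrTwo? n = (n ℕ.≟ 1) ⊎-dec (n ℕ.≟ 2)
  claim? : ∀ s m → Dec (Claim s m)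
  claim? s m = (s ℕ.+ m ℕ.<? 8) →-dec (oneOrTwo? _ ⊎-dec oneOrTwo? _)
  grid : (s m : Fin 8) → Claim (toℕ s) (toℕ m)
  grid = from-yes (Fin.all? {8} λ s → Fin.all? {8} λ m → claim? (toℕ s) (toℕ m))

module LowerBound {p h k : ℕ} (pr : Prime p) (p%4≡3 : p % 4 ≡ 3)
  (p≡1+2h : p ≡ suc (h ℕ.+ h)) (h≡1+2k : h ≡ suc (k ℕ.+ k)) where
  open 3mod4 {p} {h} {k} pr p%4≡3 p≡1+2h h≡1+2k

  ⟦_⟧ : Bool → Carrier
  ⟦ b ⟧ = if b then 1# else 0#

  -- Three or more residues can sum to zero, so nothing is recorded for them.
  IsSumOf : ℕ → Carrier → Set
  IsSumOf 0 s = s ≈ 0#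
  IsSumOf 1 s = Q p s
  IsSumOf 2 s = ∃[ u ] ∃[ v ] Q p u × Q p v × s ≈ u + v
  IsSumOf (suc (suc (suc _))) s = ⊤

  ∑-bits : ∀ {n} (f : Fin n → Bool) (a : Vector Carrier n) → (∀ i → Q p (a i)) →
           IsSumOf (count f) (∑[ i < n ] (a i * ⟦ f i ⟧))
  ∑-bits {zero}  f a qa = refl
  ∑-bits {suc n} f a qa = cons (f 0F) (count (f ∘ suc)) (qa 0F) (∑-bits (f ∘ suc) (a ∘ suc) (qa ∘ suc))
    where
    skip : ∀ {a s} → s ≈ a * 0# + s
    skip {a} {s} = reflexive (solve 2 (λ a s → s := a :* con 0# :+ s) ≡.refl a s)
    cons : ∀ b n {a s} → Q p a → IsSumOf n s → IsSumOf ((if b then suc else id) n) (a * ⟦ b ⟧ + s)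
    cons true  0 {a} {s} qa s≈0 = Q-resp (linear₁ (- 1#) s≈0
      (solve 2 (λ a s → a :- (a :* con 1# :+ s) := con (- 1#) :* (s :- con 0#)) ≡.refl a s)) qa
    cons true  1 {a} {s} qa qs = a , s , qa , qs , +-congʳ {s} (*-identityʳ a)
    cons true  2 qa _ = tt
    cons true  (suc (suc (suc _))) qa _ = tt
    cons false 0 {a} {s} qa s≈0 = trans (sym (skip {a} {s})) s≈0
    cons false 1 {a} {s} qa qs = Q-resp (skip {a} {s}) qs
    cons false 2 {a} {s} qa (u , v , qu , qv , e) = u , v , qu , qv , trans (sym (skip {a} {s})) e
    cons false (suc (suc (suc _))) qa _ = tt

  few⇒≉0 : ∀ {n s} → OneOrTwo n → IsSumOf n s → s ≉ 0#
  few⇒≉0 (inj₁ ≡.refl) qs = Q⇒≉0 qs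
  few⇒≉0 (inj₂ ≡.refl) (u , v , qu , qv , s≈u+v) s≈0 = Q+Q≉0 qu qv (trans (sym s≈u+v) s≈0)

  lower-bound : ∀ j → ((x : Vector Carrier j) → HasConsecutiveQ1ZeroSum p x) → 9 ℕ.≤ j
  lower-bound j P = ℕ.≮⇒≥ λ j<9 → refute j<9 (P λ i → ⟦ bit (toℕ i) ⟧)
    where
    refute : j ℕ.< 9 → HasConsecutiveQ1ZeroSum p {j} (λ i → ⟦ bit (toℕ i) ⟧) → ⊥
    refute j<9 (m , ι , (s , ι≡s+) , a , qa , ax≈0 , a≈0) =
      [ (λ few → few⇒≉0 few (∑-bits (λ i → bit (s ℕ.+ toℕ i)) a qa)
          (trans (sum-cong-≋ (λ i → reflexive (≡.cong (λ l → a i * ⟦ bit l ⟧) (≡.sym (ι≡s+ i))))) ax≈0))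
      -- The total weight is the weighted sum for a sequence consisting of ones only.
      , (λ few → few⇒≉0 few (∑-bits (const true) a qa) (trans (sum-cong-≋ (λ i → *-identityʳ (a i))) a≈0))
      -- The last selected position `s + m` lies below `j`, which is at most 8.
      ]′ (short-or-few-ones s m (ℕ.<-≤-trans
            (≡.subst (ℕ._< j) (≡.trans (ι≡s+ (fromℕ m)) (≡.cong (s ℕ.+_) (Fin.toℕ-fromℕ m))) (Fin.toℕ<n (ι (fromℕ m))))
            (ℕ.s≤s⁻¹ j<9)))

-- Combination of the two bounds.

theorem3p10 : (p : ℕ) → Prime p → 2 ∤ p → p % 4 ≡ 3 → p ≢ 7 → IsCQ1 p 9
theorem3p10 p pr _ p%4≡3 p≢7 = s≤s z≤n , upper (p ℕ.≟ 3) , λ j _ → lower-bound j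
  where
  -- Writing p = 4k + 3 gives h = 2k + 1.
  k = p ℕ./ 4
  arithmetic : ∀ k → 3 ℕ.+ k ℕ.* 4 ≡ suc (suc (k ℕ.+ k) ℕ.+ suc (k ℕ.+ k))
  arithmetic = ℕ-solve-∀
  p≡1+2h : p ≡ suc (suc (k ℕ.+ k) ℕ.+ suc (k ℕ.+ k))
  p≡1+2h = ≡.trans (ℕ.m≡m%n+[m/n]*n p 4) (≡.trans (≡.cong (ℕ._+ k ℕ.* 4) p%4≡3) (arithmetic k))
  open LowerBound {p} {suc (k ℕ.+ k)} {k} pr p%4≡3 p≡1+2h ≡.refl using (lower-bound)
  upper : Dec (p ≡ 3) → (x : Vector ℤ 9) → HasConsecutiveQ1ZeroSum p x
  upper (yes ≡.refl) = PrimeThree.upper-bound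
  upper (no p≢3) = UpperBound.upper-bound {p} {suc (k ℕ.+ k)} {k} pr p%4≡3 p≡1+2h ≡.refl p≢3 p≢7
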